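{- The minimum number of monochromatic triangles in a line $2$-coloring of the Young configuration, taken over all line $2$-colorings, is $0$.
   Context: A configuration is a pair $(\mathcal{P},\mathcal{L})$ with $\mathcal{P}$ a finite set of points and $\mathcal{L}$ a finite set of subsets of $\mathcal{P}$ called lines, such that any two distinct points lie together on at most one line, all points are on the same number of lines, all lines contain the same number of points, and there are at least three points. Three points $p_1,p_2,p_3$ form a triangle if there are lines $l_1,l_2,l_3$ with $p_1,p_2\in l_1$, $p_3\notin l_1$; $p_2,p_3\in l_2$, $p_1\notin l_2$; $p_1,p_3\in l_3$, $p_2\notin l_3$. The lines $l_1,l_2,l_3$ are then uniquely determined by the points. A line $2$-coloring assigns to each line one of the colors red, blue. A triangle is monochromatic if its lines $l_1,l_2,l_3$ all have the same color. The Young configuration is the $(9_4,12_3)$-configuration given by the affine plane of order $3$: points $\mathbb{F}_3^2$, lines the $12$ affine lines of $\mathbb{F}_3^2$. -}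

module Defs where

import Data.Bool.Properties as Bool
open import Data.Fin using (Fin; toℕ; combine; _<_)
open import Data.Fin.Properties using (_≟_; _<?_; any?; all?)
open import Data.Fin.Subset using (Subset; _∈_; _∉_; ∣_∣; ⁅_⁆; ⋃)
open import Data.Fin.Subset.Properties using (_∈?_)
open import Data.List
  using (List; allFin; cartesianProduct; cartesianProductWith; deduplicate; filter; length; lookup; map)
open import Data.Nat as ℕ using (ℕ)
open import Data.Nat.DivMod using (_mod_)
import Data.Nat.Properties as ℕ
open import Data.Product using (∃-syntax; _×_; _,_)
import Data.Product.Properties as Product
import Data.Vec.Properties as Vec
open import Relation.Binary.Definitions using (DecidableEquality)
open import Relation.Binary.PropositionalEquality using (_≡_; _≢_; refl)
open import Relation.Nullary.Decidable using (Dec; map′; yes; no; ¬?; _×-dec_; _→-dec_; from-yes)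

-- A (v_r , b_k)-configuration: v points, each on r lines, and b lines, each
-- containing k points.  The lines are a set of subsets of the points, so
-- they are listed without repetition.
record Configuration (v r b k : ℕ) : Set where
  field
    line           : Fin b → Subset v
    line-injective : ∀ l m → line l ≡ line m → l ≡ m
    at-most-one    : ∀ p q → p ≢ q → ∀ l m →
                     p ∈ line l × q ∈ line l → p ∈ line m × q ∈ line m → l ≡ m
    point-degree   : ∀ p → length (filter (λ l → p ∈? line l) (allFin b)) ≡ r
    line-size      : ∀ l → ∣ line l ∣ ≡ k
    three-points   : 3 ℕ.≤ v

data Colour : Set where
  red blue : Colour

_≟ᶜ_ : DecidableEquality Colour
red  ≟ᶜ red  = yes refl
red  ≟ᶜ blue = no λ ()
blue ≟ᶜ red  = no λ ()
blue ≟ᶜ blue = yes refl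

module _ {v r b k : ℕ} (C : Configuration v r b k) where
  open Configuration C

  LineColouring : Set
  LineColouring = Fin b → Colour

  Sides : (p₁ p₂ p₃ : Fin v) (l₁ l₂ l₃ : Fin b) → Set
  Sides p₁ p₂ p₃ l₁ l₂ l₃ =
    (p₁ ∈ line l₁ × p₂ ∈ line l₁ × p₃ ∉ line l₁) ×
    (p₂ ∈ line l₂ × p₃ ∈ line l₂ × p₁ ∉ line l₂) ×
    (p₁ ∈ line l₃ × p₃ ∈ line l₃ × p₂ ∉ line l₃)

  sides? : ∀ p₁ p₂ p₃ l₁ l₂ l₃ → Dec (Sides p₁ p₂ p₃ l₁ l₂ l₃)
  sides? p₁ p₂ p₃ l₁ l₂ l₃ =
    (p₁ ∈? line l₁ ×-dec p₂ ∈? line l₁ ×-dec ¬? (p₃ ∈? line l₁)) ×-dec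
    (p₂ ∈? line l₂ ×-dec p₃ ∈? line l₂ ×-dec ¬? (p₁ ∈? line l₂)) ×-dec
    (p₁ ∈? line l₃ ×-dec p₃ ∈? line l₃ ×-dec ¬? (p₂ ∈? line l₃))

  Triangle : (p₁ p₂ p₃ : Fin v) → Set
  Triangle p₁ p₂ p₃ = ∃[ l₁ ] ∃[ l₂ ] ∃[ l₃ ] Sides p₁ p₂ p₃ l₁ l₂ l₃

  sides-unique : ∀ {p₁ p₂ p₃ l₁ l₂ l₃ m₁ m₂ m₃} →
    Sides p₁ p₂ p₃ l₁ l₂ l₃ → Sides p₁ p₂ p₃ m₁ m₂ m₃ →
    l₁ ≡ m₁ × l₂ ≡ m₂ × l₃ ≡ m₃
  sides-unique {p₁} {p₂} {p₃}
    ((a , b , c) , (d , e , f) , (g , h , i))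
    ((a′ , b′ , _) , (d′ , e′ , _) , (g′ , h′ , _)) =
    at-most-one p₁ p₂ (λ { refl → f d }) _ _ (a , b) (a′ , b′) ,
    at-most-one p₂ p₃ (λ { refl → c b }) _ _ (d , e) (d′ , e′) ,
    at-most-one p₁ p₃ (λ { refl → c a }) _ _ (g , h) (g′ , h′)

  Monochromatic : LineColouring → ∀ {p₁ p₂ p₃} → Triangle p₁ p₂ p₃ → Set
  Monochromatic c (l₁ , l₂ , l₃ , _) = c l₁ ≡ c l₂ × c l₂ ≡ c l₃

  -- By sides-unique the sides carried by the Triangle are determined by the
  -- points, so this is a property of the points alone.
  MonochromaticTriangle : LineColouring → (p₁ p₂ p₃ : Fin v) → Set
  MonochromaticTriangle c p₁ p₂ p₃ =
    ∃[ T ] Monochromatic c {p₁} {p₂} {p₃} T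

  monochromaticTriangle? : ∀ c p₁ p₂ p₃ → Dec (MonochromaticTriangle c p₁ p₂ p₃)
  monochromaticTriangle? c p₁ p₂ p₃ =
    map′ (λ (l₁ , l₂ , l₃ , s , m) → (l₁ , l₂ , l₃ , s) , m)
         (λ ((l₁ , l₂ , l₃ , s) , m) → l₁ , l₂ , l₃ , s , m)
         (any? λ l₁ → any? λ l₂ → any? λ l₃ →
           sides? p₁ p₂ p₃ l₁ l₂ l₃ ×-dec c l₁ ≟ᶜ c l₂ ×-dec c l₂ ≟ᶜ c l₃)

  -- The vertices of a triangle form an unordered triple of distinct points,
  -- counted once through its increasing enumeration.
  IncreasingMonochromatic : LineColouring → Fin v × Fin v × Fin v → Set
  IncreasingMonochromatic c (p₁ , p₂ , p₃) =
    (p₁ < p₂ × p₂ < p₃) × MonochromaticTriangle c p₁ p₂ p₃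

  increasingMonochromatic? : ∀ c t → Dec (IncreasingMonochromatic c t)
  increasingMonochromatic? c (p₁ , p₂ , p₃) =
    (p₁ <? p₂ ×-dec p₂ <? p₃) ×-dec monochromaticTriangle? c p₁ p₂ p₃

  pointTriples : List (Fin v × Fin v × Fin v)
  pointTriples = cartesianProduct (allFin v) (cartesianProduct (allFin v) (allFin v))

  #monochromaticTriangles : LineColouring → ℕ
  #monochromaticTriangles c = length (filter (increasingMonochromatic? c) pointTriples)

IsMinimum : {A : Set} → (A → ℕ) → ℕ → Set
IsMinimum f m = (∃[ x ] f x ≡ m) × (∀ x → m ℕ.≤ f x)

𝔽₃ : Set
𝔽₃ = Fin 3

infixl 6 _+₃_
infixl 7 _*₃_

_+₃_ _*₃_ : 𝔽₃ → 𝔽₃ → 𝔽₃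
x +₃ y = (toℕ x ℕ.+ toℕ y) mod 3
x *₃ y = (toℕ x ℕ.* toℕ y) mod 3

𝔽₃² : List (𝔽₃ × 𝔽₃)
𝔽₃² = cartesianProduct (allFin 3) (allFin 3)

-- The line { p + t d ∣ t ∈ 𝔽₃ }, with 𝔽₃² identified with Fin 9 by combine.
affineLine : 𝔽₃ × 𝔽₃ → 𝔽₃ × 𝔽₃ → Subset 9
affineLine (x , y) (dx , dy) =
  ⋃ (map (λ t → ⁅ combine (x +₃ t *₃ dx) (y +₃ t *₃ dy) ⁆) (allFin 3))

nonzero : List (𝔽₃ × 𝔽₃)
nonzero = filter (λ d → ¬? (Product.≡-dec _≟_ _≟_ d (Fin.zero , Fin.zero))) 𝔽₃²

affineLines : List (Subset 9)
affineLines = deduplicate (Vec.≡-dec Bool._≟_) (cartesianProductWith affineLine 𝔽₃² nonzero)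

-- The lines are passed as an argument so that evaluating the decision
-- procedure computes them only once.
atMostOne? : ∀ {v b} (line : Fin b → Subset v) →
  Dec (∀ p q → p ≢ q → ∀ l m →
       p ∈ line l × q ∈ line l → p ∈ line m × q ∈ line m → l ≡ m)
atMostOne? line =
  all? λ p → all? λ q → ¬? (p ≟ q) →-dec
    (all? λ l → all? λ m →
      (p ∈? line l ×-dec q ∈? line l) →-dec
      ((p ∈? line m ×-dec q ∈? line m) →-dec (l ≟ m)))

young : Configuration 9 4 12 3
young = record
  { line           = line
  ; line-injective = from-yes (all? λ l → all? λ m →
                       Vec.≡-dec Bool._≟_ (line l) (line m) →-dec l ≟ m)
  ; at-most-one    = from-yes (atMostOne? line)
  ; point-degree   = from-yes (all? λ p →
                       length (filter (λ l → p ∈? line l) (allFin 12)) ℕ.≟ 4)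
  ; line-size      = from-yes (all? λ l → ∣ line l ∣ ℕ.≟ 3)
  ; three-points   = from-yes (3 ℕ.≤? 9)
  }
  where
  line : Fin 12 → Subset 9
  line = lookup affineLines

{-# OPTIONS --safe #-}
-- Two sides of a triangle meet, whereas two lines in the same direction are
-- equal or disjoint, so the sides of a triangle have three distinct directions.
-- There are four directions; painting two of them red and the other two blue
-- leaves no colour with three directions.
module Submission where

open import Data.Fin using (Fin)
open import Data.Fin.Patterns
open import Data.Fin.Properties using (_≟_; all?)
open import Data.Fin.Subset using (Subset; _∈_)
open import Data.Fin.Subset.Properties using (_∈?_)
open import Data.List using (length)
open import Data.List.Properties using (filter-none)
import Data.List.Relation.Unary.All as All
open import Data.Nat using (ℕ; z≤n)
open import Data.Product using (_,_)
open import Data.Sum using (_⊎_; inj₁; inj₂)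
open import Data.Vec using ([]; _∷_; lookup)
open import Relation.Binary.PropositionalEquality using (_≡_; cong; subst)
open import Relation.Nullary using (¬_)
open import Relation.Nullary.Decidable using (Dec; from-yes; _→-dec_; _⊎-dec_)

open import Defs

-- The only trace of parallelism that the argument uses, so `direction` can be an arbitrary
-- labelling.
ParallelDisjoint : ∀ {v b d} → (Fin b → Subset v) → (Fin b → Fin d) → Set
ParallelDisjoint line direction =
  ∀ p l m → p ∈ line l → p ∈ line m → direction l ≡ direction m → l ≡ m

parallelDisjoint? : ∀ {v b d} (line : Fin b → Subset v) (direction : Fin b → Fin d) →
  Dec (ParallelDisjoint line direction)
parallelDisjoint? line direction =
  all? λ p → all? λ l → all? λ m →
    p ∈? line l →-dec (p ∈? line m →-dec (direction l ≟ direction m →-dec l ≟ m))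

-- At most two directions per colour, in pigeonhole form: the disjunction tells which two sides are
-- parallel.
TwoPerColour : ∀ {d} → (Fin d → Colour) → Set
TwoPerColour colour = ∀ x y z →
  colour x ≡ colour y → colour y ≡ colour z → x ≡ y ⊎ y ≡ z ⊎ x ≡ z

twoPerColour? : ∀ {d} (colour : Fin d → Colour) → Dec (TwoPerColour colour)
twoPerColour? colour =
  all? λ x → all? λ y → all? λ z →
    colour x ≟ᶜ colour y →-dec (colour y ≟ᶜ colour z →-dec
      (x ≟ y ⊎-dec (y ≟ z ⊎-dec x ≟ z)))

module _ {v r b k d : ℕ} (C : Configuration v r b k)
  (direction : Fin b → Fin d) (colour : Fin d → Colour)
  (parallel-disjoint : ParallelDisjoint (Configuration.line C) direction)
  (two-per-colour : TwoPerColour colour) where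

  open Configuration C using (line)

  directionColouring : LineColouring C
  directionColouring l = colour (direction l)

  -- Any two sides share a vertex, so equal directions would make them one line; but each has a
  -- vertex that the other misses.
  ¬monochromaticTriangle : ∀ p₁ p₂ p₃ →
    ¬ MonochromaticTriangle C directionColouring p₁ p₂ p₃
  ¬monochromaticTriangle p₁ p₂ p₃
    ((l₁ , l₂ , l₃ ,
      (p₁∈l₁ , p₂∈l₁ , _) , (p₂∈l₂ , p₃∈l₂ , p₁∉l₂) , (p₁∈l₃ , p₃∈l₃ , p₂∉l₃)) ,
     c₁≡c₂ , c₂≡c₃)
    with two-per-colour (direction l₁) (direction l₂) (direction l₃) c₁≡c₂ c₂≡c₃
  ... | inj₁ d₁≡d₂ =
    p₁∉l₂ (subst (λ l → p₁ ∈ line l) (parallel-disjoint p₂ l₁ l₂ p₂∈l₁ p₂∈l₂ d₁≡d₂) p₁∈l₁)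
  ... | inj₂ (inj₁ d₂≡d₃) =
    p₂∉l₃ (subst (λ l → p₂ ∈ line l) (parallel-disjoint p₃ l₂ l₃ p₃∈l₂ p₃∈l₃ d₂≡d₃) p₂∈l₂)
  ... | inj₂ (inj₂ d₁≡d₃) =
    p₂∉l₃ (subst (λ l → p₂ ∈ line l) (parallel-disjoint p₁ l₁ l₃ p₁∈l₁ p₁∈l₃ d₁≡d₃) p₂∈l₁)

  -- Only attainment has content, as counts are natural numbers.
  minimum-zero : IsMinimum (#monochromaticTriangles C) 0
  minimum-zero =
    (directionColouring ,
     cong length
       (filter-none (increasingMonochromatic? C directionColouring)
         (All.universal (λ (p₁ , p₂ , p₃) (_ , T) → ¬monochromaticTriangle p₁ p₂ p₃ T)
           (pointTriples C)))) ,
    λ _ → z≤n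

-- The entries follow the order in which deduplicate lists the lines; the
-- directions (0,1), (1,0), (1,1), (1,2) are numbered 0, 1, 2, 3.
youngDirection : Fin 12 → Fin 4
youngDirection = lookup
  (0F ∷ 1F ∷ 2F ∷ 3F ∷ 1F ∷ 2F ∷ 3F ∷ 1F ∷ 2F ∷ 3F ∷ 0F ∷ 0F ∷ [])

-- Any other split into two and two would serve.
youngColour : Fin 4 → Colour
youngColour = lookup (red ∷ red ∷ blue ∷ blue ∷ [])

theorem4p3 : IsMinimum (#monochromaticTriangles young) 0
theorem4p3 = minimum-zero young youngDirection youngColour
  -- Nine points hold at most three disjoint three-point lines, so this check forces each of the
  -- four labels to mark a full parallel class.
  (from-yes (parallelDisjoint? (Configuration.line young) youngDirection))
  (from-yes (twoPerColour? youngColour))
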